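{- Let $\varepsilon>0$ and $0<\delta<1$, and let $f$ be a graph function for $n$-node graphs with publicly known spread $(s(n),\ell(n))$ that spares an edge $e$; write $\ell=\ell(n)$. There is an absolute constant $c>0$ such that the following holds for graph sequences of length $T$ on graphs of size $n$, whenever $$T>2\ell\,\log_2\!\left(\frac{e^{4\varepsilon\ell}}{1-\delta}\right)\in O\!\left(\varepsilon\ell^2+\ell\log\tfrac{1}{1-\delta}\right).$$ Every (fully dynamic) algorithm that is $\varepsilon$-edge-differentially private on user-level and that computes $f$ with probability at least $1-\delta$ must have error $\Omega(s(n))$. That is, if $s(n)>0$, there is no such algorithm that, on every graph sequence of length $T$, with probability at least $1-\delta$ outputs at all time steps $t$ values differing from $f(G_t)$ by less than $c\cdot s(n)$.
   Context: Graphs are undirected (possibly edge-weighted) on $n$ nodes. A graph sequence $(G_1,\dots,G_T)$ arises from an initial graph $G_0=(V,E_0)$ through edge updates: $E_t=(E_{t-1}\setminus\partial E_t^-)\cup\partial E_t^+$, where $\partial E_t^+$ is the set of inserted and $\partial E_t^-$ the set of deleted edges; insertions and deletions may be mixed arbitrarily (fully dynamic). Event-level edge-adjacency on $e^*$: two sequences of the same length with the same initial graph and the same node set such that (up to exchanging them) there is a time $t^*$ with either all deletion sets equal, $\partial E_t^+=\partial E_t'^+$ for $t\neq t^*$, $\partial E_{t^*}'^+\subseteq\partial E_{t^*}^+$ and $\partial E_{t^*}^+\setminus\partial E_{t^*}'^+=\{e^*\}$; or the same with the roles of insertions and deletions exchanged. Two sequences $\mathcal G,\mathcal G'$ are edge-adjacent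 on user-level if there are an edge $e^*$ and a finite chain of graph sequences from $\mathcal G$ to $\mathcal G'$ in which consecutive sequences are event-level edge-adjacent on the same edge $e^*$. A randomized online algorithm $\mathcal A$ (which outputs a real number after each update, depending only on the input so far) is $\varepsilon$-edge-differentially private on user-level if $\Pr[\mathcal A(\mathcal G)\in S]\le e^\varepsilon\Pr[\mathcal A(\mathcal G')\in S]$ for all user-level edge-adjacent $\mathcal G,\mathcal G'$ and all (measurable) sets $S$ of output sequences. Spread: let $s,\ell:\mathbb N\to\{2i\mid i\in\mathbb N\}$. A graph function $f$ (mapping graphs to real numbers) has spread $(s(n),\ell(n))$ on graphs of size $n$ if for every $n$ there exist graphs $G_1,G_2$ of size $n$ with $|f(G_1)-f(G_2)|\ge s(n)$ such that the minimum length of a sequence of single-edge updates (each inserting or deleting one edge) transforming $G_1$ into $G_2$ is $\ell(n)$. It spares an edge $e$ if moreover $e\in E(G_1)\cap E(G_2)$. -}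

module Defs where

open import Level using (0ℓ)
import Level
open import Algebra.Bundles using (CommutativeRing)
import Algebra.Construct.NaturalChoice.Max as Max
import Algebra.Definitions.RawMonoid as RawMonoidDefinitions
open import Data.Fin.Base as Fin using (Fin; zero; suc; toℕ; inject≤)
open import Data.Fin.Properties using (toℕ<n)
open import Data.Maybe using (Maybe; just; nothing; Is-just; _<∣>_)
open import Data.Nat.Base as ℕ using (ℕ; zero; suc)
open import Data.Product.Base using (∃; ∃-syntax; _×_)
open import Data.Sum.Base using (_⊎_)
open import Data.Unit.Base using (⊤)
open import Data.Vec.Functional using (Vector; tail)
open import Function.Bundles using (Func)
open import Relation.Binary.Bundles using (Setoid; TotalOrder)
open import Relation.Binary.Construct.Closure.ReflexiveTransitive using (Star)
open import Relation.Binary.Construct.Closure.Symmetric using (SymClosure)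
import Relation.Binary.Construct.NonStrictToStrict as NonStrictToStrict
open import Relation.Binary.PropositionalEquality
  using (_≡_; _≢_; _≗_; _→-setoid_)
open import Relation.Binary.Structures using (IsTotalOrder)
open import Relation.Nullary using (¬_)
open import Relation.Unary using (Pred; _∈_; Satisfiable; _≐_; _⊥_; U; ∁; ⋃)

------------------------------------------------------------------------
-- Real numbers

-- The real numbers up to isomorphism: a Dedekind-complete ordered field.
--
-- exp and log add no freedom.  exp-+ and 1+x≤exp give
-- (1 + x/k)^k ≤ exp x ≤ (1 - x/k)^(-k) for all large k, so exp is the
-- exponential function; log is its inverse on the positive reals.
-- _⁻¹ and log are total, with unspecified values at 0 and at x ≤ 0
-- respectively.

record RealNumbers : Set₁ where
  infix  8 _⁻¹
  infix  4 _≤_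
  field
    commutativeRing : CommutativeRing 0ℓ 0ℓ

  open CommutativeRing commutativeRing public
    renaming (Carrier to ℝ; setoid to ℝ-setoid)

  field
    _≤_          : ℝ → ℝ → Set
    isTotalOrder : IsTotalOrder _≈_ _≤_
    0≉1          : 0# ≉ 1#
    _⁻¹          : ℝ → ℝ
    *-inverseʳ   : ∀ x → x ≉ 0# → x * x ⁻¹ ≈ 1#
    +-monoʳ-≤    : ∀ x {y z} → y ≤ z → x + y ≤ x + z
    *-nonNeg     : ∀ {x y} → 0# ≤ x → 0# ≤ y → 0# ≤ x * y

  totalOrder : TotalOrder 0ℓ 0ℓ 0ℓ
  totalOrder = record { isTotalOrder = isTotalOrder }

  open NonStrictToStrict _≈_ _≤_ public using (_<_)
  open Max totalOrder public using (_⊔_)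
  open RawMonoidDefinitions +-rawMonoid
    renaming (_×_ to _·_) using (sum)

  IsUpperBound : Pred ℝ 0ℓ → ℝ → Set
  IsUpperBound S b = ∀ x → x ∈ S → x ≤ b

  field
    complete : (S : Pred ℝ 0ℓ) → Satisfiable S → ∃ (IsUpperBound S) →
               ∃[ u ] IsUpperBound S u × (∀ b → IsUpperBound S b → u ≤ b)
    exp      : ℝ → ℝ
    exp-cong : ∀ {x y} → x ≈ y → exp x ≈ exp y
    exp-+    : ∀ x y → exp (x + y) ≈ exp x * exp y
    1+x≤exp  : ∀ x → 1# + x ≤ exp x
    log      : ℝ → ℝ
    exp-log  : ∀ x → 0# < x → exp (log x) ≈ x

  infixl 7 _/_
  _/_ : ℝ → ℝ → ℝ
  x / y = x * y ⁻¹

  fromℕ : ℕ → ℝ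
  fromℕ k = k · 1#

  log₂ : ℝ → ℝ
  log₂ x = log x / log (fromℕ 2)

  ∣_∣ : ℝ → ℝ
  ∣ x ∣ = x ⊔ (- x)

  partialSum : (ℕ → ℝ) → ℕ → ℝ
  partialSum a m = sum {m} (λ i → a (toℕ i))

  _SumsTo_ : (ℕ → ℝ) → ℝ → Set
  a SumsTo x = ∀ η → 0# < η →
    ∃[ N ] ∀ m → N ℕ.≤ m → ∣ partialSum a m - x ∣ < η

------------------------------------------------------------------------
-- Graphs on the node set Fin n

-- An unordered pair of distinct nodes, listed in increasing order.
record Edge (n : ℕ) : Set where
  constructor edge
  field
    lower upper    : Fin n
    .lower<upper   : lower Fin.< upper

-- A set of edges, each carrying a weight in W; nothing marks absence.
-- The unweighted case is W = ⊤.
EdgeSet : Set → ℕ → Set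
EdgeSet W n = Edge n → Maybe W

Graph : Set → ℕ → Set
Graph = EdgeSet

module _ {W : Set} {n : ℕ} where

  infix 4 _∈ᴱ_ _∉ᴱ_

  _∈ᴱ_ _∉ᴱ_ : Edge n → EdgeSet W n → Set
  e ∈ᴱ X = Is-just (X e)
  e ∉ᴱ X = X e ≡ nothing

  -- Y ⊆ X and X ∖ Y = { e }
  IsExtension : Edge n → EdgeSet W n → EdgeSet W n → Set
  IsExtension e X Y =
    e ∈ᴱ X × e ∉ᴱ Y × (∀ e′ → e′ ≢ e → X e′ ≡ Y e′)

  SingleEdgeUpdate : Graph W n → Graph W n → Set
  SingleEdgeUpdate G H =
    ∃[ e ] (IsExtension e H G ⊎ IsExtension e G H)

  data _⟶[_]_ : Graph W n → ℕ → Graph W n → Set where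
    done : ∀ {G H} → G ≗ H → G ⟶[ 0 ] H
    step : ∀ {G H K k} →
           SingleEdgeUpdate G H → H ⟶[ k ] K → G ⟶[ suc k ] K

  IsUpdateDistance : Graph W n → Graph W n → ℕ → Set
  IsUpdateDistance G H ℓ = G ⟶[ ℓ ] H × (∀ k → G ⟶[ k ] H → ℓ ℕ.≤ k)

------------------------------------------------------------------------
-- Graph sequences

record Update (W : Set) (n : ℕ) : Set where
  field
    inserted : EdgeSet W n
    deleted  : EdgeSet ⊤ n

open Update public

module _ {W : Set} {n : ℕ} where

  remove : EdgeSet ⊤ n → Graph W n → Graph W n
  remove D G e with D e
  ... | just _  = nothing
  ... | nothing = G e

  -- (E ∖ ∂E⁻) ∪ ∂E⁺
  apply : Graph W n → Update W n → Graph W n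
  apply G u e = inserted u e <∣> remove (deleted u) G e

record GraphSeq (W : Set) (n T : ℕ) : Set where
  field
    initial : Graph W n
    updates : Vector (Update W n) T

open GraphSeq public

module _ {W : Set} {n : ℕ} where

  -- The entry at index t : Fin T is the graph after update number
  -- toℕ t + 1.
  graphsFrom : ∀ {T} → Graph W n → Vector (Update W n) T →
               Vector (Graph W n) T
  graphsFrom G us zero    = apply G (us zero)
  graphsFrom G us (suc t) = graphsFrom (apply G (us zero)) (tail us) t

  graphs : ∀ {T} → GraphSeq W n T → Vector (Graph W n) T
  graphs 𝒢 = graphsFrom (initial 𝒢) (updates 𝒢)

  -- The input up to and including the update at index t.
  prefix : ∀ {T} → GraphSeq W n T → (t : Fin T) →
           GraphSeq W n (suc (toℕ t))
  prefix 𝒢 t = record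
    { initial = initial 𝒢
    ; updates = λ i → updates 𝒢 (inject≤ i (toℕ<n t))
    }

  module _ {T : ℕ} where

    ins : GraphSeq W n T → Fin T → EdgeSet W n
    ins 𝒢 t = inserted (updates 𝒢 t)

    del : GraphSeq W n T → Fin T → EdgeSet ⊤ n
    del 𝒢 t = deleted (updates 𝒢 t)

    OneExtraInsertion OneExtraDeletion :
      Edge n → GraphSeq W n T → GraphSeq W n T → Set
    OneExtraInsertion e 𝒢 𝒢′ =
      (∀ t → del 𝒢 t ≗ del 𝒢′ t) ×
      (∃[ t* ] (∀ t → t ≢ t* → ins 𝒢 t ≗ ins 𝒢′ t) ×
               IsExtension e (ins 𝒢 t*) (ins 𝒢′ t*))
    OneExtraDeletion e 𝒢 𝒢′ =
      (∀ t → ins 𝒢 t ≗ ins 𝒢′ t) ×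
      (∃[ t* ] (∀ t → t ≢ t* → del 𝒢 t ≗ del 𝒢′ t) ×
               IsExtension e (del 𝒢 t*) (del 𝒢′ t*))

    OneExtraEvent : Edge n → GraphSeq W n T → GraphSeq W n T → Set
    OneExtraEvent e 𝒢 𝒢′ =
      initial 𝒢 ≗ initial 𝒢′ ×
      (OneExtraInsertion e 𝒢 𝒢′ ⊎ OneExtraDeletion e 𝒢 𝒢′)

    EventLevelAdjacent : Edge n → GraphSeq W n T → GraphSeq W n T → Set
    EventLevelAdjacent e = SymClosure (OneExtraEvent e)

    UserLevelAdjacent : GraphSeq W n T → GraphSeq W n T → Set
    UserLevelAdjacent 𝒢 𝒢′ = ∃[ e ] Star (EventLevelAdjacent e) 𝒢 𝒢′

------------------------------------------------------------------------
-- Probability, graph functions and private algorithms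

record IsSigmaAlgebra {X : Set} (𝓕 : Pred (Pred X 0ℓ) (Level.suc 0ℓ)) : Set₁ where
  field
    resp-≐   : ∀ {A B} → A ≐ B → 𝓕 A → 𝓕 B
    U-closed : 𝓕 U
    ∁-closed : ∀ {A} → 𝓕 A → 𝓕 (∁ A)
    ⋃-closed : ∀ {A : ℕ → Pred X 0ℓ} → (∀ i → 𝓕 (A i)) → 𝓕 (⋃ ℕ A)

module _ (R : RealNumbers) where
  open RealNumbers R

  -- Pr is total; it is constrained on events only.
  record ProbabilitySpace : Set₂ where
    field
      Ω              : Set
      Event          : Pred (Pred Ω 0ℓ) (Level.suc 0ℓ)
      isSigmaAlgebra : IsSigmaAlgebra Event
      Pr             : Pred Ω 0ℓ → ℝ
      Pr-cong        : ∀ {A B} → Event A → A ≐ B → Pr A ≈ Pr B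
      Pr-nonNeg      : ∀ {A} → Event A → 0# ≤ Pr A
      Pr-U           : Pr U ≈ 1#
      Pr-⋃           : ∀ (A : ℕ → Pred Ω 0ℓ) → (∀ i → Event (A i)) →
                       (∀ {i j} → i ≢ j → A i ⊥ A j) →
                       (λ i → Pr (A i)) SumsTo Pr (⋃ ℕ A)

  -- The product Borel σ-algebra on ℝ^T, generated by the sets
  -- { x ∣ a < x t < b }.
  data Borel {T : ℕ} : Pred (Pred (Vector ℝ T) 0ℓ) (Level.suc 0ℓ) where
    interval   : ∀ t a b → Borel (λ x → a < x t × x t < b)
    resp-≐     : ∀ {A B} → A ≐ B → Borel A → Borel B
    whole      : Borel U
    complement : ∀ {A} → Borel A → Borel (∁ A)
    union      : ∀ {A : ℕ → Pred (Vector ℝ T) 0ℓ} →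
                 (∀ i → Borel (A i)) → Borel (⋃ ℕ A)

  GraphFunction : Set → ℕ → Set
  GraphFunction W n = Func (Edge n →-setoid Maybe W) ℝ-setoid

  module _ {W : Set} {n : ℕ} where

    -- Spread (s , ℓ) at size n, witnessed by graphs both containing e.
    HasSpreadSparing : GraphFunction W n → ℕ → ℕ → Edge n → Set
    HasSpreadSparing f s ℓ e =
      ∃[ G₁ ] ∃[ G₂ ]
        fromℕ s ≤ ∣ Func.to f G₁ - Func.to f G₂ ∣ ×
        IsUpdateDistance G₁ G₂ ℓ ×
        e ∈ᴱ G₁ × e ∈ᴱ G₂

  -- run 𝒢 ω is the number released after the last update of 𝒢 when the
  -- internal randomness is ω.
  record OnlineAlgorithm (W : Set) (n : ℕ) : Set₂ where
    field
      space : ProbabilitySpace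
    open ProbabilitySpace space public
    field
      run        : ∀ {t} → GraphSeq W n t → Ω → ℝ
      measurable : ∀ {t} (𝒢 : GraphSeq W n t) a b →
                   Event (λ ω → a < run 𝒢 ω × run 𝒢 ω < b)

    outputs : ∀ {T} → GraphSeq W n T → Ω → Vector ℝ T
    outputs 𝒢 ω t = run (prefix 𝒢 t) ω

  module _ {W : Set} {n : ℕ} (𝒜 : OnlineAlgorithm W n) (T : ℕ) where
    open OnlineAlgorithm 𝒜

    IsUserLevelEdgePrivate : ℝ → Set₁
    IsUserLevelEdgePrivate ε =
      ∀ (𝒢 𝒢′ : GraphSeq W n T) → UserLevelAdjacent 𝒢 𝒢′ →
      ∀ S → Borel S →
      Pr (λ ω → outputs 𝒢 ω ∈ S) ≤ exp ε * Pr (λ ω → outputs 𝒢′ ω ∈ S)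

    -- On each input, with probability at least p, all errors are below r.
    ComputesWithin : GraphFunction W n → ℝ → ℝ → Set
    ComputesWithin f r p =
      ∀ (𝒢 : GraphSeq W n T) →
      p ≤ Pr (λ ω → ∀ t → ∣ outputs 𝒢 ω t - Func.to f (graphs 𝒢 t) ∣ < r)

  lengthThreshold : ℝ → ℝ → ℕ → ℝ
  lengthThreshold ε δ ℓ =
    fromℕ 2 * fromℕ ℓ *
    log₂ (exp (fromℕ 4 * ε * fromℕ ℓ) / (1# - δ))

{-# OPTIONS --safe #-}

-- Let G₁ and G₂ witness the spread.  Since an update may replace the whole
-- graph, every word b ∈ {1,2}^T is the trajectory of a sequence whose graph
-- after update t is G_{b t}.  Along a shortest update path from G₁ to G₂,
-- changing the graphs at all times with b t = 2 by one step of the path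
-- affects a single edge, so the sequence of b is reached from the constant
-- one by ℓ user-level adjacencies, plus one accounting for graphs that agree
-- only pointwise.  Group privacy gives the constant sequence probability at
-- least (1 - δ) exp(-(ℓ + 1)ε) of an output within s/2 of the values for b.
-- These 2^T events are disjoint, hence 2^T (1 - δ) ≤ exp((ℓ + 1)ε), which
-- contradicts the lower bound on T.

module Submission where

open import Level using (0ℓ)
import Level
open import Axiom.ExcludedMiddle using (ExcludedMiddle)
open import Data.Empty using (⊥-elim)
open import Data.Fin.Base using (Fin; zero; suc; toℕ; fromℕ<; combine; finToFun; funToFin)
open import Data.Fin.Properties
  using (toℕ<n; toℕ-injective; toℕ-fromℕ<; funToFin-finToFin; _≟_)
open import Data.Maybe using (Maybe; just; nothing; Is-just)
open import Data.Maybe.Relation.Unary.Any using (just)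
open import Data.Nat.Base as ℕ using (ℕ; zero; suc)
open import Data.Nat.Divisibility using (_∣_)
import Data.Nat.Properties as ℕ
open import Data.Product.Base using (∃-syntax; _×_; _,_; proj₂)
open import Data.Sum.Base using (_⊎_; inj₁; inj₂)
open import Data.Unit.Base using (⊤; tt)
open import Data.Vec.Functional using (Vector; tail)
open import Function.Base using (_∘_)
open import Function.Bundles using (Func)
open import Relation.Binary.Bundles using (TotalOrder)
open import Relation.Binary.Construct.Closure.ReflexiveTransitive
  using (Star; _◅_; _◅◅_; reverse) renaming (ε to nil)
open import Relation.Binary.Construct.Closure.Symmetric using (fwd; bwd; symmetric)
open import Relation.Binary.PropositionalEquality as ≡ using (_≡_; _≢_; _≗_)
open import Relation.Nullary using (¬_; Dec; yes; no; contradiction)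
open import Relation.Nullary.Decidable using (decidable-stable)
open import Relation.Unary using (Pred; _∈_; _≐_; _⊥_; ∁; ⋃)
open import Defs

-- Arithmetic and order in a complete ordered field.

module Reals (em : ExcludedMiddle 0ℓ) (R : RealNumbers) where
  open RealNumbers R hiding (zero)
  open TotalOrder totalOrder public using (poset; total; antisym)
    renaming (reflexive to ≤-reflexive; refl to ≤-refl; trans to ≤-trans)
  open import Relation.Binary.Reasoning.PartialOrder poset
  open import Relation.Binary.Construct.NonStrictToStrict _≈_ _≤_ as ToStrict
    using (<⇒≤)
  open import Algebra.Properties.Ring ring
    using (-0#≈0#; -‿distribʳ-*; -‿involutive; +-cancelˡ)
  open import Algebra.Properties.AbelianGroup +-abelianGroup using ()
    renaming (\\-leftDividesʳ to -x+[x+y]≈y; \\-leftDividesˡ to x+[-x+y]≈y;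
              ⁻¹-anti-homo‿- to -[x-y]≈y-x; x≈y⇒x∙y⁻¹≈ε to x≈y⇒x-y≈0)
  open import Algebra.Construct.NaturalChoice.Max totalOrder
    using (⊔-sel; ⊔-cong; ⊔-idem; x≤x⊔y; x≤y⊔x)
  open import Algebra.Properties.Semiring.Mult semiring using (×1-homo-*)
  open import Algebra.Solver.Ring.NaturalCoefficients.Default commutativeSemiring
    using (solve; _:=_; _:+_; _:*_; con)

  ≰⇒> : ∀ {x y} → ¬ (x ≤ y) → y < x
  ≰⇒> = ToStrict.≰⇒> sym ≤-reflexive total

  ≮⇒≥ : ∀ {x y} → ¬ (x < y) → y ≤ x
  ≮⇒≥ = ToStrict.≮⇒≥ sym (λ _ _ → em) ≤-reflexive total

  <⇒≱ : ∀ {x y} → x < y → ¬ (y ≤ x)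
  <⇒≱ = ToStrict.<⇒≱ antisym

  <⇒≉˘ : ∀ {x y} → x < y → y ≉ x
  <⇒≉˘ x<y y≈x = proj₂ x<y (sym y≈x)

  +-monoˡ-≤ : ∀ x {y z} → y ≤ z → y + x ≤ z + x
  +-monoˡ-≤ x {y} {z} y≤z = begin
    y + x  ≈⟨ +-comm y x ⟩
    x + y  ≤⟨ +-monoʳ-≤ x y≤z ⟩
    x + z  ≈⟨ +-comm x z ⟩
    z + x  ∎

  +-mono-≤ : ∀ {x y u v} → x ≤ y → u ≤ v → x + u ≤ y + v
  +-mono-≤ x≤y u≤v = ≤-trans (+-monoˡ-≤ _ x≤y) (+-monoʳ-≤ _ u≤v)

  +-cancelˡ-≤ : ∀ x {y z} → x + y ≤ x + z → y ≤ z
  +-cancelˡ-≤ x {y} {z} le = begin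
    y              ≈⟨ -x+[x+y]≈y x y ⟨
    - x + (x + y)  ≤⟨ +-monoʳ-≤ (- x) le ⟩
    - x + (x + z)  ≈⟨ -x+[x+y]≈y x z ⟩
    z              ∎

  +-monoʳ-< : ∀ x {y z} → y < z → x + y < x + z
  +-monoʳ-< x (y≤z , y≉z) =
    +-monoʳ-≤ x y≤z , λ eq → y≉z (+-cancelˡ x _ _ eq)

  +-monoˡ-< : ∀ x {y z} → y < z → y + x < z + x
  +-monoˡ-< x {y} {z} y<z = begin-strict
    y + x  ≈⟨ +-comm y x ⟩
    x + y  <⟨ +-monoʳ-< x y<z ⟩
    x + z  ≈⟨ +-comm x z ⟩
    z + x  ∎

  +-nonNeg : ∀ {x y} → 0# ≤ x → 0# ≤ y → 0# ≤ x + y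
  +-nonNeg 0≤x 0≤y = ≤-trans (≤-reflexive (sym (+-identityˡ 0#))) (+-mono-≤ 0≤x 0≤y)

  x≤x+y : ∀ {x y} → 0# ≤ y → x ≤ x + y
  x≤x+y {x} {y} 0≤y = begin
    x       ≈⟨ +-identityʳ x ⟨
    x + 0#  ≤⟨ +-monoʳ-≤ x 0≤y ⟩
    x + y   ∎

  x+[y-x]≈y : ∀ x y → x + (y - x) ≈ y
  x+[y-x]≈y x y = trans (+-congˡ (+-comm y (- x))) (x+[-x+y]≈y x y)

  x≤y⇒0≤y-x : ∀ {x y} → x ≤ y → 0# ≤ y - x
  x≤y⇒0≤y-x {x} {y} x≤y = +-cancelˡ-≤ x (begin
    x + 0#       ≈⟨ +-identityʳ x ⟩
    x            ≤⟨ x≤y ⟩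
    y            ≈⟨ x+[y-x]≈y x y ⟨
    x + (y - x)  ∎)

  x<y⇒0<y-x : ∀ {x y} → x < y → 0# < y - x
  x<y⇒0<y-x {x} {y} (x≤y , x≉y) = x≤y⇒0≤y-x x≤y , λ 0≈y-x → x≉y
    (trans (sym (+-identityʳ x)) (trans (+-congˡ 0≈y-x) (x+[y-x]≈y x y)))

  *-monoˡ-≤ : ∀ {x} → 0# ≤ x → ∀ {y z} → y ≤ z → x * y ≤ x * z
  *-monoˡ-≤ {x} 0≤x {y} {z} y≤z = begin
    x * y                ≤⟨ x≤x+y (*-nonNeg 0≤x (x≤y⇒0≤y-x y≤z)) ⟩
    x * y + x * (z - y)  ≈⟨ distribˡ x y (z - y) ⟨
    x * (y + (z - y))    ≈⟨ *-congˡ (x+[y-x]≈y y z) ⟩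
    x * z                ∎

  *-monoʳ-≤ : ∀ {x} → 0# ≤ x → ∀ {y z} → y ≤ z → y * x ≤ z * x
  *-monoʳ-≤ {x} 0≤x {y} {z} y≤z = begin
    y * x  ≈⟨ *-comm y x ⟩
    x * y  ≤⟨ *-monoˡ-≤ 0≤x y≤z ⟩
    x * z  ≈⟨ *-comm x z ⟩
    z * x  ∎

  *-inverseˡ-cancel : ∀ {x} → x ≉ 0# → ∀ y → (y * x) * x ⁻¹ ≈ y
  *-inverseˡ-cancel {x} x≉0 y = begin-equality
    (y * x) * x ⁻¹  ≈⟨ *-assoc y x (x ⁻¹) ⟩
    y * (x * x ⁻¹)  ≈⟨ *-congˡ (*-inverseʳ x x≉0) ⟩
    y * 1#          ≈⟨ *-identityʳ y ⟩
    y               ∎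

  *-cancelʳ-≈ : ∀ {x} → x ≉ 0# → ∀ {y z} → y * x ≈ z * x → y ≈ z
  *-cancelʳ-≈ {x} x≉0 {y} {z} eq = begin-equality
    y               ≈⟨ *-inverseˡ-cancel x≉0 y ⟨
    (y * x) * x ⁻¹  ≈⟨ *-congʳ eq ⟩
    (z * x) * x ⁻¹  ≈⟨ *-inverseˡ-cancel x≉0 z ⟩
    z               ∎

  *-pos : ∀ {x y} → 0# < x → 0# < y → 0# < x * y
  *-pos {x} {y} 0<x 0<y = *-nonNeg (<⇒≤ 0<x) (<⇒≤ 0<y) , λ 0≈xy →
    proj₂ 0<x (*-cancelʳ-≈ (<⇒≉˘ 0<y) (trans (zeroˡ y) 0≈xy))

  -- If 1 were at most 0, then -1 would be nonnegative, and so would its square, which is 1.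
  0≤1 : 0# ≤ 1#
  0≤1 with total 0# 1#
  ... | inj₁ 0≤1 = 0≤1
  ... | inj₂ 1≤0 = begin
    0#           ≤⟨ *-nonNeg 0≤-1 0≤-1 ⟩
    - 1# * - 1#  ≈⟨ -‿distribʳ-* (- 1#) 1# ⟨
    - (- 1# * 1#)  ≈⟨ -‿cong (*-identityʳ (- 1#)) ⟩
    - (- 1#)     ≈⟨ -‿involutive 1# ⟩
    1#           ∎
    where
    0≤-1 : 0# ≤ - 1#
    0≤-1 = ≤-trans (x≤y⇒0≤y-x 1≤0) (≤-reflexive (+-identityˡ (- 1#)))

  0<1 : 0# < 1#
  0<1 = 0≤1 , 0≉1

  ⁻¹-pos : ∀ {x} → 0# < x → 0# < x ⁻¹
  ⁻¹-pos {x} 0<x = ≰⇒> λ x⁻¹≤0 → <⇒≱ 0<1 (begin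
    1#        ≈⟨ *-inverseʳ x (<⇒≉˘ 0<x) ⟨
    x * x ⁻¹  ≤⟨ *-monoˡ-≤ (<⇒≤ 0<x) x⁻¹≤0 ⟩
    x * 0#    ≈⟨ zeroʳ x ⟩
    0#        ∎)

  -- Natural numbers

  0≤fromℕ : ∀ k → 0# ≤ fromℕ k
  0≤fromℕ zero    = ≤-refl
  0≤fromℕ (suc k) = +-nonNeg 0≤1 (0≤fromℕ k)

  1≤fromℕ : ∀ {k} → 0 ℕ.< k → 1# ≤ fromℕ k
  1≤fromℕ {suc k} _ = x≤x+y (0≤fromℕ k)

  0<fromℕ : ∀ {k} → 0 ℕ.< k → 0# < fromℕ k
  0<fromℕ {k} 0<k = begin-strict
    0#       <⟨ 0<1 ⟩
    1#       ≤⟨ 1≤fromℕ 0<k ⟩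
    fromℕ k  ∎

  0<2 : 0# < fromℕ 2
  0<2 = 0<fromℕ {2} (ℕ.s≤s ℕ.z≤n)

  1≤1/x : ∀ {x} → 0# < x → x ≤ 1# → 1# ≤ 1# / x
  1≤1/x {x} 0<x x≤1 = begin
    1#         ≈⟨ *-inverseʳ x (<⇒≉˘ 0<x) ⟨
    x * x ⁻¹   ≤⟨ *-monoʳ-≤ (<⇒≤ (⁻¹-pos 0<x)) x≤1 ⟩
    1# * x ⁻¹  ∎

  -- Absolute values

  -- Differences are turned into sums, so that what remains are
  -- semiring identities.
  x-y<z⇒x<y+z : ∀ {x y z} → x - y < z → x < y + z
  x-y<z⇒x<y+z {x} {y} {z} lt = begin-strict
    x            ≈⟨ x+[y-x]≈y y x ⟨
    y + (x - y)  <⟨ +-monoʳ-< y lt ⟩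
    y + z        ∎

  x<y+z⇒x-y<z : ∀ {x y z} → x < y + z → x - y < z
  x<y+z⇒x-y<z {x} {y} {z} lt = begin-strict
    x - y          <⟨ +-monoˡ-< (- y) lt ⟩
    (y + z) - y    ≈⟨ +-comm (y + z) (- y) ⟩
    - y + (y + z)  ≈⟨ -x+[x+y]≈y y z ⟩
    z              ∎

  ∣x∣<y⇒x<y : ∀ {x y} → ∣ x ∣ < y → x < y
  ∣x∣<y⇒x<y {x} {y} lt = begin-strict
    x      ≤⟨ x≤x⊔y x (- x) ⟩
    ∣ x ∣  <⟨ lt ⟩
    y      ∎

  ∣x∣<y⇒-x<y : ∀ {x y} → ∣ x ∣ < y → - x < y
  ∣x∣<y⇒-x<y {x} {y} lt = begin-strict
    - x    ≤⟨ x≤y⊔x x (- x) ⟩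
    ∣ x ∣  <⟨ lt ⟩
    y      ∎

  ∣x∣<y : ∀ {x y} → x < y → - x < y → ∣ x ∣ < y
  ∣x∣<y {x} {y} x<y -x<y with ⊔-sel x (- x)
  ... | inj₁ eq = begin-strict ∣ x ∣ ≈⟨ eq ⟩ x   <⟨ x<y ⟩  y ∎
  ... | inj₂ eq = begin-strict ∣ x ∣ ≈⟨ eq ⟩ - x <⟨ -x<y ⟩ y ∎

  ∣x-y∣<z⇒x<y+z : ∀ {x y z} → ∣ x - y ∣ < z → x < y + z
  ∣x-y∣<z⇒x<y+z lt = x-y<z⇒x<y+z (∣x∣<y⇒x<y lt)

  ∣x-y∣<z⇒y<x+z : ∀ {x y z} → ∣ x - y ∣ < z → y < x + z
  ∣x-y∣<z⇒y<x+z {x} {y} {z} lt = x-y<z⇒x<y+z (begin-strict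
    y - x      ≈⟨ -[x-y]≈y-x x y ⟨
    - (x - y)  <⟨ ∣x∣<y⇒-x<y lt ⟩
    z          ∎)

  ∣x-y∣<z : ∀ {x y z} → x < y + z → y < x + z → ∣ x - y ∣ < z
  ∣x-y∣<z {x} {y} {z} lt gt = ∣x∣<y (x<y+z⇒x-y<z lt) (begin-strict
    - (x - y)  ≈⟨ -[x-y]≈y-x x y ⟩
    y - x      <⟨ x<y+z⇒x-y<z gt ⟩
    z          ∎)

  ∣x-y∣<z⇒bounds : ∀ {x y z} → ∣ x - y ∣ < z → y - z < x × x < y + z
  ∣x-y∣<z⇒bounds {x} {y} {z} lt =
    x<y+z⇒x-y<z (begin-strict
      y      <⟨ ∣x-y∣<z⇒y<x+z lt ⟩
      x + z  ≈⟨ +-comm x z ⟩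
      z + x  ∎) ,
    ∣x-y∣<z⇒x<y+z lt

  bounds⇒∣x-y∣<z : ∀ {x y z} → y - z < x × x < y + z → ∣ x - y ∣ < z
  bounds⇒∣x-y∣<z {x} {y} {z} (lower , upper) = ∣x-y∣<z upper (begin-strict
    y      <⟨ x-y<z⇒x<y+z lower ⟩
    z + x  ≈⟨ +-comm z x ⟩
    x + z  ∎)

  ∣-∣-triangle-< : ∀ {u x y r s} → ∣ u - x ∣ < r → ∣ u - y ∣ < s → x < y + (s + r)
  ∣-∣-triangle-< {u} {x} {y} {r} {s} ux uy = begin-strict
    x            <⟨ ∣x-y∣<z⇒y<x+z ux ⟩
    u + r        <⟨ +-monoˡ-< r (∣x-y∣<z⇒x<y+z uy) ⟩
    (y + s) + r  ≈⟨ +-assoc y s r ⟩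
    y + (s + r)  ∎

  ∣u-x∣<r⇒∣u-y∣<r⇒∣x-y∣<r+r : ∀ {u x y r} →
    ∣ u - x ∣ < r → ∣ u - y ∣ < r → ∣ x - y ∣ < r + r
  ∣u-x∣<r⇒∣u-y∣<r⇒∣x-y∣<r+r ux uy =
    ∣x-y∣<z (∣-∣-triangle-< ux uy) (∣-∣-triangle-< uy ux)

  ∣∣-cong : ∀ {x y} → x ≈ y → ∣ x ∣ ≈ ∣ y ∣
  ∣∣-cong x≈y = ⊔-cong x≈y (-‿cong x≈y)

  x≈y⇒∣x-y∣≈0 : ∀ {x y} → x ≈ y → ∣ x - y ∣ ≈ 0#
  x≈y⇒∣x-y∣≈0 {x} {y} x≈y = begin-equality
    ∣ x - y ∣  ≈⟨ ∣∣-cong (x≈y⇒x-y≈0 x≈y) ⟩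
    0# ⊔ - 0#  ≈⟨ ⊔-cong refl -0#≈0# ⟩
    0# ⊔ 0#    ≈⟨ ⊔-idem 0# ⟩
    0#         ∎

  -- The exponential function and the logarithm

  1≤exp : ∀ {x} → 0# ≤ x → 1# ≤ exp x
  1≤exp {x} 0≤x = begin
    1#      ≤⟨ x≤x+y 0≤x ⟩
    1# + x  ≤⟨ 1+x≤exp x ⟩
    exp x   ∎

  -- For nonpositive `x`, the product `exp (- x) * exp x` is `exp 0#`, which is at least 1, while
  -- `exp (- x)` is nonnegative; so `exp x` cannot be at most 0.
  0<exp : ∀ x → 0# < exp x
  0<exp x with total 0# x
  ... | inj₁ 0≤x = begin-strict
    0#     <⟨ 0<1 ⟩
    1#     ≤⟨ 1≤exp 0≤x ⟩
    exp x  ∎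
  ... | inj₂ x≤0 = ≰⇒> λ exp≤0 → <⇒≱ 0<1 (begin
    1#                   ≤⟨ 1≤exp ≤-refl ⟩
    exp 0#               ≈⟨ exp-cong (-‿inverseˡ x) ⟨
    exp (- x + x)        ≈⟨ exp-+ (- x) x ⟩
    exp (- x) * exp x    ≤⟨ *-monoˡ-≤ 0≤exp-x exp≤0 ⟩
    exp (- x) * 0#       ≈⟨ zeroʳ (exp (- x)) ⟩
    0#                   ∎)
    where
    0≤-x : 0# ≤ - x
    0≤-x = ≤-trans (x≤y⇒0≤y-x x≤0) (≤-reflexive (+-identityˡ (- x)))
    0≤exp-x : 0# ≤ exp (- x)
    0≤exp-x = ≤-trans 0≤1 (1≤exp 0≤-x)

  exp-0 : exp 0# ≈ 1#
  exp-0 = *-cancelʳ-≈ (<⇒≉˘ (0<exp 0#)) (begin-equality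
    exp 0# * exp 0#  ≈⟨ exp-+ 0# 0# ⟨
    exp (0# + 0#)    ≈⟨ exp-cong (+-identityʳ 0#) ⟩
    exp 0#           ≈⟨ *-identityˡ (exp 0#) ⟨
    1# * exp 0#      ∎)

  exp-inverseʳ : ∀ x → exp x * exp (- x) ≈ 1#
  exp-inverseʳ x = begin-equality
    exp x * exp (- x)  ≈⟨ exp-+ x (- x) ⟨
    exp (x - x)        ≈⟨ exp-cong (-‿inverseʳ x) ⟩
    exp 0#             ≈⟨ exp-0 ⟩
    1#                 ∎

  -- The tangent bound `1+x≤exp` at `y - x`, scaled by the positive factor `exp x`, already gives
  -- strict growth.
  exp-mono-< : ∀ {x y} → x < y → exp x < exp y
  exp-mono-< {x} {y} x<y = begin-strict
    exp x                          ≈⟨ +-identityʳ (exp x) ⟨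
    exp x + 0#                     <⟨ +-monoʳ-< (exp x) (*-pos (0<exp x) (x<y⇒0<y-x x<y)) ⟩
    exp x + exp x * (y - x)        ≈⟨ +-congʳ (*-identityʳ (exp x)) ⟨
    exp x * 1# + exp x * (y - x)   ≈⟨ distribˡ (exp x) 1# (y - x) ⟨
    exp x * (1# + (y - x))         ≤⟨ *-monoˡ-≤ (<⇒≤ (0<exp x)) (1+x≤exp (y - x)) ⟩
    exp x * exp (y - x)            ≈⟨ exp-+ x (y - x) ⟨
    exp (x + (y - x))              ≈⟨ exp-cong (x+[y-x]≈y x y) ⟩
    exp y                          ∎

  exp-cancel-≤ : ∀ {x y} → exp x ≤ exp y → x ≤ y
  exp-cancel-≤ le = ≮⇒≥ λ y<x → <⇒≱ (exp-mono-< y<x) le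

  exp-mono-≤ : ∀ {x y} → x ≤ y → exp x ≤ exp y
  exp-mono-≤ {x} {y} x≤y with em {P = x ≈ y}
  ... | yes x≈y = ≤-reflexive (exp-cong x≈y)
  ... | no  x≉y = <⇒≤ (exp-mono-< (x≤y , x≉y))

  -- `exp` reflects the order, hence is injective, so a value of `log` can be verified after
  -- applying `exp`.
  exp[y]≈x⇒log[x]≈y : ∀ {x y} → 0# < x → exp y ≈ x → log x ≈ y
  exp[y]≈x⇒log[x]≈y {x} {y} 0<x eq = antisym
    (exp-cancel-≤ (≤-reflexive exp-log≈exp))
    (exp-cancel-≤ (≤-reflexive (sym exp-log≈exp)))
    where
    exp-log≈exp : exp (log x) ≈ exp y
    exp-log≈exp = trans (exp-log x 0<x) (sym eq)

  exp[y]≤x⇒y≤log[x] : ∀ {x y} → 0# < x → exp y ≤ x → y ≤ log x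
  exp[y]≤x⇒y≤log[x] {x} {y} 0<x le = exp-cancel-≤ (begin
    exp y        ≤⟨ le ⟩
    x            ≈⟨ exp-log x 0<x ⟨
    exp (log x)  ∎)

  1≤x⇒0≤log[x] : ∀ {x} → 1# ≤ x → 0# ≤ log x
  1≤x⇒0≤log[x] {x} 1≤x =
    exp[y]≤x⇒y≤log[x] 0<x (≤-trans (≤-reflexive exp-0) 1≤x)
    where
    0<x : 0# < x
    0<x = begin-strict 0# <⟨ 0<1 ⟩ 1# ≤⟨ 1≤x ⟩ x ∎

  0<log[2] : 0# < log (fromℕ 2)
  0<log[2] = 1≤x⇒0≤log[x] (<⇒≤ 1<2) , λ 0≈log → proj₂ 1<2 (begin-equality
    1#                   ≈⟨ exp-0 ⟨
    exp 0#               ≈⟨ exp-cong 0≈log ⟩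
    exp (log (fromℕ 2))  ≈⟨ exp-log (fromℕ 2) 0<2 ⟩
    fromℕ 2              ∎)
    where
    1<2 : 1# < fromℕ 2
    1<2 = begin-strict
      1#       ≈⟨ +-identityʳ 1# ⟨
      1# + 0#  <⟨ +-monoʳ-< 1# (0<fromℕ {1} (ℕ.s≤s ℕ.z≤n)) ⟩
      fromℕ 2  ∎

  -- This puts the number of words of length `k` on the same scale as the privacy factors, which are
  -- values of `exp`.
  fromℕ-2^ : ∀ k → fromℕ (2 ℕ.^ k) ≈ exp (fromℕ k * log (fromℕ 2))
  fromℕ-2^ zero = begin-equality
    fromℕ 1                     ≈⟨ +-identityʳ 1# ⟩
    1#                          ≈⟨ exp-0 ⟨
    exp 0#                      ≈⟨ exp-cong (zeroˡ (log (fromℕ 2))) ⟨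
    exp (0# * log (fromℕ 2))    ∎
  fromℕ-2^ (suc k) = begin-equality
    fromℕ (2 ℕ.* 2 ℕ.^ k)       ≈⟨ ×1-homo-* 2 (2 ℕ.^ k) ⟩
    fromℕ 2 * fromℕ (2 ℕ.^ k)   ≈⟨ *-cong (exp-log (fromℕ 2) 0<2) (sym (fromℕ-2^ k)) ⟨
    exp L * exp (fromℕ k * L)   ≈⟨ exp-+ L (fromℕ k * L) ⟨
    exp (L + fromℕ k * L)       ≈⟨ exp-cong (solve 2 (λ l m →
                                     l :+ m :* l := (con 1 :+ m) :* l) refl L (fromℕ k)) ⟩
    exp (fromℕ (suc k) * L)     ∎
    where
    L : ℝ
    L = log (fromℕ 2)

-- Finite families in a sigma-algebra.

module SigmaAlgebra (em : ExcludedMiddle 0ℓ) {X : Set} {𝓕 : Pred (Pred X 0ℓ) (Level.suc 0ℓ)}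
                    (isSigmaAlgebra : IsSigmaAlgebra 𝓕) where
  open IsSigmaAlgebra isSigmaAlgebra renaming (resp-≐ to 𝓕-resp-≐)

  -- Extends a finite family to one indexed by all natural numbers, with empty sets past `N`, so
  -- that the countable axioms apply to it.
  at : ∀ {N} → (Fin N → Pred X 0ℓ) → ℕ → Pred X 0ℓ
  at A k x = ∃[ i ] toℕ i ≡ k × A i x

  at-toℕ : ∀ {N} (A : Fin N → Pred X 0ℓ) i → A i ≐ at A (toℕ i)
  at-toℕ A i = (λ x∈Ai → i , ≡.refl , x∈Ai) , λ (j , j≡i , x∈Aj) →
    ≡.subst (λ j → A j _) (toℕ-injective j≡i) x∈Aj

  at-closed : ∀ {N} {A : Fin N → Pred X 0ℓ} → (∀ i → 𝓕 (A i)) → ∀ k → 𝓕 (at A k)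
  at-closed {N} {A} A∈𝓕 k with em {P = ∃[ i ] toℕ {N} i ≡ k}
  ... | yes (i , ≡.refl) = 𝓕-resp-≐ (at-toℕ A i) (A∈𝓕 i)
  ... | no  none = 𝓕-resp-≐
    ((λ x∉U → ⊥-elim (x∉U tt)) , λ (i , i≡k , _) → ⊥-elim (none (i , i≡k)))
    (∁-closed U-closed)

  -- De Morgan: a finite intersection is the complement of a union of complements, the double
  -- negation being removed classically.
  ∀-closed : ∀ {N} {A : Fin N → Pred X 0ℓ} → (∀ i → 𝓕 (A i)) →
             𝓕 (λ x → ∀ i → A i x)
  ∀-closed {N} {A} A∈𝓕 = 𝓕-resp-≐ {A = ∁ (⋃ ℕ (at λ i → ∁ (A i)))}
    ( (λ none i → decidable-stable em λ x∉Ai → none (toℕ i , i , ≡.refl , x∉Ai))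
    , λ all (k , i , i≡k , x∉Ai) → x∉Ai (all i) )
    (∁-closed (⋃-closed (at-closed λ i → ∁-closed (A∈𝓕 i))))

Borel-isSigmaAlgebra : ∀ R {T} → IsSigmaAlgebra (Borel R {T})
Borel-isSigmaAlgebra R = record
  { resp-≐   = Borel.resp-≐
  ; U-closed = whole
  ; ∁-closed = complement
  ; ⋃-closed = union
  }

-- Disjoint events in a probability space.

module Probability (em : ExcludedMiddle 0ℓ) (R : RealNumbers) (P : ProbabilitySpace R) where
  open RealNumbers R hiding (zero)
  open Reals em R
  open ProbabilitySpace P
  open IsSigmaAlgebra isSigmaAlgebra
  open SigmaAlgebra em isSigmaAlgebra
  open import Relation.Binary.Reasoning.PartialOrder poset

  -- Countable additivity controls only late partial sums, so `m` may exceed `N`; the terms past `N`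
  -- are nonnegative and can be discarded.
  N*p≤partialSum : ∀ {p} {a : ℕ → ℝ} N m → N ℕ.≤ m → (∀ k → 0# ≤ a k) →
                   (∀ (i : Fin N) → p ≤ a (toℕ i)) → fromℕ N * p ≤ partialSum a m
  N*p≤partialSum {p} zero zero _ _ _ = ≤-reflexive (zeroˡ p)
  N*p≤partialSum {p} {a} zero (suc m) _ 0≤a _ = begin
    0# * p              ≈⟨ zeroˡ p ⟩
    0#                  ≤⟨ +-nonNeg (0≤a 0) (≤-trans (≤-reflexive (sym (zeroˡ p)))
                             (N*p≤partialSum {p} 0 m ℕ.z≤n (0≤a ∘ suc) λ ())) ⟩
    partialSum a (suc m)  ∎
  N*p≤partialSum {p} {a} (suc N) (suc m) (ℕ.s≤s N≤m) 0≤a p≤a = begin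
    (1# + fromℕ N) * p               ≈⟨ distribʳ p 1# (fromℕ N) ⟩
    1# * p + fromℕ N * p             ≈⟨ +-congʳ (*-identityˡ p) ⟩
    p + fromℕ N * p                  ≤⟨ +-mono-≤ (p≤a zero)
                                          (N*p≤partialSum N m N≤m (0≤a ∘ suc) (p≤a ∘ suc)) ⟩
    a 0 + partialSum (a ∘ suc) m     ∎

  -- Completing the family by its complement gives a partition of Ω, so
  -- no monotonicity of Pr is needed.
  disjoint⇒N*p≤1 : ∀ {N p} (E : Fin N → Pred Ω 0ℓ) → (∀ i → Event (E i)) →
                   (∀ {i j} → i ≢ j → E i ⊥ E j) → (∀ i → p ≤ Pr (E i)) →
                   fromℕ N * p ≤ 1#
  disjoint⇒N*p≤1 {N} {p} E E-event E-disjoint p≤PrE = ≮⇒≥ λ 1<Np →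
    -- The tolerance is the assumed excess of `fromℕ N * p` over 1. The partial sum is taken past
    -- `M` and past all `N` events; the successor makes room for the complement at index 0.
    let (M , close) = Pr-⋃ A A-event A-disjoint (fromℕ N * p - 1#) (x<y⇒0<y-x 1<Np)
        m = M ℕ.+ N
    in <⇒≱ (begin-strict
      partialSum a (suc m)                  <⟨ ∣x-y∣<z⇒x<y+z
                                                 (close (suc m) (ℕ.m≤n⇒m≤1+n (ℕ.m≤m+n M N))) ⟩
      Pr (⋃ ℕ A) + (fromℕ N * p - 1#)       ≈⟨ +-congʳ Pr[⋃A]≈1 ⟩
      1# + (fromℕ N * p - 1#)               ≈⟨ x+[y-x]≈y 1# (fromℕ N * p) ⟩
      fromℕ N * p                           ∎)
      (begin
      fromℕ N * p                           ≤⟨ N*p≤partialSum N m (ℕ.m≤n+m N M)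
                                                 (a-nonNeg ∘ suc) p≤a ⟩
      partialSum (a ∘ suc) m                ≈⟨ +-identityˡ _ ⟨
      0# + partialSum (a ∘ suc) m           ≤⟨ +-monoˡ-≤ _ (a-nonNeg 0) ⟩
      partialSum a (suc m)                  ∎)
    where
    A : ℕ → Pred Ω 0ℓ
    A zero    = ∁ (⋃ ℕ (at E))
    A (suc k) = at E k

    a : ℕ → ℝ
    a k = Pr (A k)

    A-event : ∀ k → Event (A k)
    A-event zero    = ∁-closed (⋃-closed (at-closed E-event))
    A-event (suc k) = at-closed E-event k

    a-nonNeg : ∀ k → 0# ≤ a k
    a-nonNeg k = Pr-nonNeg (A-event k)

    A-disjoint : ∀ {j k} → j ≢ k → A j ⊥ A k
    A-disjoint {zero}  {zero}  j≢k _           = j≢k ≡.refl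
    A-disjoint {zero}  {suc k} _   (rest , ω∈) = rest (k , ω∈)
    A-disjoint {suc j} {zero}  _   (ω∈ , rest) = rest (j , ω∈)
    A-disjoint {suc j} {suc k} j≢k ((i , i≡j , ω∈Ei) , (i′ , i′≡k , ω∈Ei′)) =
      E-disjoint (λ i≡i′ → j≢k (≡.cong suc
        (≡.trans (≡.sym i≡j) (≡.trans (≡.cong toℕ i≡i′) i′≡k)))) (ω∈Ei , ω∈Ei′)

    Pr[⋃A]≈1 : Pr (⋃ ℕ A) ≈ 1#
    Pr[⋃A]≈1 = trans
      (Pr-cong (⋃-closed A-event) ((λ _ → tt) , λ {ω} _ → covered ω)) Pr-U
      where
      covered : ∀ ω → ω ∈ ⋃ ℕ A
      covered ω with em {P = ω ∈ ⋃ ℕ (at E)}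
      ... | yes (k , ω∈) = suc k , ω∈
      ... | no  rest     = zero , rest

    p≤a : ∀ i → p ≤ a (suc (toℕ i))
    p≤a i = ≤-trans (p≤PrE i) (≤-reflexive (Pr-cong (E-event i) (at-toℕ E i)))

-- Sequences with prescribed graphs and their adjacency.

module Sequences (em : ExcludedMiddle 0ℓ) {W : Set} {n : ℕ} where

  -- Deleting every edge and reinserting those of H reaches H in a
  -- single update, whatever the preceding graph.
  replaceBy : Graph W n → Update W n
  replaceBy H = record { inserted = H ; deleted = λ _ → just tt }

  empty : Graph W n
  empty _ = nothing

  sequence : ∀ {T} → Vector (Graph W n) T → GraphSeq W n T
  sequence h = record { initial = empty ; updates = replaceBy ∘ h }

  apply-replaceBy : ∀ G H → apply G (replaceBy H) ≗ H
  apply-replaceBy G H e with H e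
  ... | just _  = ≡.refl
  ... | nothing = ≡.refl

  graphsFrom-replaceBy : ∀ {T} G (h : Vector (Graph W n) T) t →
                         graphsFrom G (replaceBy ∘ h) t ≗ h t
  graphsFrom-replaceBy G h zero    = apply-replaceBy G (h zero)
  graphsFrom-replaceBy G h (suc t) =
    graphsFrom-replaceBy (apply G (replaceBy (h zero))) (tail h) t

  graphs-sequence : ∀ {T} (h : Vector (Graph W n) T) t → graphs (sequence h) t ≗ h t
  graphs-sequence = graphsFrom-replaceBy empty

  IsExtension-resp : ∀ {e : Edge n} {X X′ Y Y′ : Graph W n} → X ≗ X′ → Y ≗ Y′ →
                     IsExtension e X Y → IsExtension e X′ Y′
  IsExtension-resp X≗X′ Y≗Y′ (e∈X , e∉Y , rest) =
    ≡.subst Is-just (X≗X′ _) e∈X ,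
    ≡.trans (≡.sym (Y≗Y′ _)) e∉Y ,
    λ e′ e′≢e → ≡.trans (≡.sym (X≗X′ e′)) (≡.trans (rest e′ e′≢e) (Y≗Y′ e′))

  -- Equality is included because a step of the update path leaves the graphs at unselected times as
  -- they are.
  DropsAtMost : Edge n → Graph W n → Graph W n → Set
  DropsAtMost e G H = G ≗ H ⊎ IsExtension e G H

  module _ {T : ℕ} (e : Edge n) where

    Adjacent : GraphSeq W n T → GraphSeq W n T → Set
    Adjacent = Star (EventLevelAdjacent e)

    Adjacent-sym : ∀ {𝒢 𝒢′} → Adjacent 𝒢 𝒢′ → Adjacent 𝒢′ 𝒢
    Adjacent-sym = reverse (symmetric (OneExtraEvent e))

    -- Sequences that agree only pointwise are not equal, and the chain
    -- of length 0 does not connect them; omitting one deletion and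
    -- restoring it does.
    ≗⇒Adjacent : Fin T → ∀ {h h′ : Vector (Graph W n) T} →
                 (∀ t → h t ≗ h′ t) → Adjacent (sequence h) (sequence h′)
    ≗⇒Adjacent t* {h} {h′} h≗h′ =
      fwd (onePlus (λ _ _ → ≡.refl)) ◅ bwd (onePlus (λ t e′ → ≡.sym (h≗h′ t e′))) ◅ nil
      where
      deletions : ∀ t e′ → Dec (t ≡ t*) → Dec (e′ ≡ e) → Maybe ⊤
      deletions t e′ (yes _) (yes _) = nothing
      deletions t e′ (yes _) (no  _) = just tt
      deletions t e′ (no  _) _       = just tt

      middle : GraphSeq W n T
      middle = record
        { initial = empty
        ; updates = λ t → record
          { inserted = h t ; deleted = λ e′ → deletions t e′ em em } }

      -- The deletion clause compares insertion sets pointwise, so every sequence agreeing pointwise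
      -- with `h` is `middle` with one more deletion. Both endpoints are of this kind.
      onePlus : ∀ {k} → (∀ t → k t ≗ h t) → OneExtraEvent e (sequence k) middle
      onePlus k≗h = (λ _ → ≡.refl) , inj₂ (k≗h , t* , other , just tt , missing , rest)
        where
        other : ∀ t → t ≢ t* → ∀ e′ → just tt ≡ deletions t e′ em em
        other t t≢t* e′ with em {P = t ≡ t*}
        ... | yes t≡t* = contradiction t≡t* t≢t*
        ... | no  _    = ≡.refl

        missing : deletions t* e em em ≡ nothing
        missing with em {P = t* ≡ t*} | em {P = e ≡ e}
        ... | yes _   | yes _   = ≡.refl
        ... | yes _   | no  e≢e = contradiction ≡.refl e≢e
        ... | no t≢t  | _       = contradiction ≡.refl t≢t

        rest : ∀ e′ → e′ ≢ e → just tt ≡ deletions t* e′ em em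
        rest e′ e′≢e with em {P = t* ≡ t*} | em {P = e′ ≡ e}
        ... | yes _ | yes e′≡e = contradiction e′≡e e′≢e
        ... | yes _ | no  _    = ≡.refl
        ... | no  _ | _        = ≡.refl

    -- An event-level change affects one time only, so the drops are made time by time, by induction
    -- on a bound `m` from which on both sequences agree. All of them concern the same edge `e`, so
    -- the links form one user-level chain.
    dropsBefore⇒Adjacent : Fin T → ∀ m {h h′ : Vector (Graph W n) T} →
      (∀ t → DropsAtMost e (h t) (h′ t)) → (∀ t → m ℕ.≤ toℕ t → h t ≗ h′ t) →
      Adjacent (sequence h) (sequence h′)
    dropsBefore⇒Adjacent t₀ zero drops same = ≗⇒Adjacent t₀ (λ t → same t ℕ.z≤n)
    dropsBefore⇒Adjacent t₀ (suc m) {h} {h′} drops same with m ℕ.<? T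
    -- No time has index `m`, so the bound decreases with nothing to change.
    ... | no m≮T = dropsBefore⇒Adjacent t₀ m drops λ t m≤t →
      contradiction (ℕ.≤-<-trans m≤t (toℕ<n t)) m≮T
    ... | yes m<T = dropsBefore⇒Adjacent t₀ m drops′ same′ ◅◅ last (drops t*)
      where
      t* : Fin T
      t* = fromℕ< m<T

      choose : ∀ t → Dec (t ≡ t*) → Graph W n
      choose t (yes _) = h t
      choose t (no  _) = h′ t

      -- The change at `t*` is left for last: `h″` agrees with `h` from `m` on and with `h′` at
      -- every time other than `t*`.
      h″ : Vector (Graph W n) T
      h″ t = choose t (t ≟ t*)

      drops′ : ∀ t → DropsAtMost e (h t) (h″ t)
      drops′ t with t ≟ t*
      ... | yes _ = inj₁ (λ _ → ≡.refl)
      ... | no  _ = drops t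

      same′ : ∀ t → m ℕ.≤ toℕ t → h t ≗ h″ t
      same′ t m≤t with t ≟ t*
      ... | yes _    = λ _ → ≡.refl
      ... | no  t≢t* = same t (ℕ.≤∧≢⇒< m≤t λ m≡t → t≢t*
        (toℕ-injective (≡.trans (≡.sym m≡t) (≡.sym (toℕ-fromℕ< m<T)))))

      h″≗h′ : ∀ t → t ≢ t* → h″ t ≗ h′ t
      h″≗h′ t t≢t* with t ≟ t*
      ... | yes t≡t* = contradiction t≡t* t≢t*
      ... | no  _    = λ _ → ≡.refl

      h≗h″ : h t* ≗ h″ t*
      h≗h″ with t* ≟ t*
      ... | yes _   = λ _ → ≡.refl
      ... | no  t≢t = contradiction ≡.refl t≢t

      last : DropsAtMost e (h t*) (h′ t*) → Adjacent (sequence h″) (sequence h′)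
      last (inj₁ h≗h′) = ≗⇒Adjacent t₀ λ t e′ → unchanged t (t ≟ t*) e′
        where
        unchanged : ∀ t → Dec (t ≡ t*) → h″ t ≗ h′ t
        unchanged t (yes ≡.refl) e′ = ≡.trans (≡.sym (h≗h″ e′)) (h≗h′ e′)
        unchanged t (no t≢t*)    e′ = h″≗h′ t t≢t* e′
      last (inj₂ ext) = fwd ((λ _ → ≡.refl) , inj₁
        ( (λ _ _ → ≡.refl) , t* , h″≗h′
        , IsExtension-resp h≗h″ (λ _ → ≡.refl) ext)) ◅ nil

    drops⇒Adjacent : Fin T → ∀ {h h′ : Vector (Graph W n) T} →
      (∀ t → DropsAtMost e (h t) (h′ t)) → Adjacent (sequence h) (sequence h′)
    drops⇒Adjacent t₀ drops = dropsBefore⇒Adjacent t₀ T drops λ t T≤t →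
      contradiction (toℕ<n t) (ℕ.≤⇒≯ T≤t)

-- Turns pointwise equality of two words into equality of their indices.
funToFin-cong : ∀ {m k} {f g : Fin m → Fin k} → f ≗ g → funToFin f ≡ funToFin g
funToFin-cong {zero}  f≗g = ≡.refl
funToFin-cong {suc m} f≗g =
  ≡.cong₂ combine (f≗g zero) (funToFin-cong (f≗g ∘ suc))

-- Estimates for the length threshold.

module Threshold (em : ExcludedMiddle 0ℓ) (R : RealNumbers) where
  open RealNumbers R hiding (zero)
  open Reals em R
  open import Relation.Binary.Reasoning.PartialOrder poset
  open import Relation.Binary.Construct.NonStrictToStrict _≈_ _≤_ using (<⇒≤)
  open import Algebra.Solver.Ring.NaturalCoefficients.Default commutativeSemiring
    using (solve; _:=_; _:+_; _:*_; con)

  private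
    L L⁻¹ : ℝ
    L = log (fromℕ 2)
    L⁻¹ = L ⁻¹

  0≤L⁻¹ : 0# ≤ L⁻¹
  0≤L⁻¹ = <⇒≤ (⁻¹-pos 0<log[2])

  -- The first summand is the exact coefficient of `ε` times the square of `ℓ` in the threshold, the
  -- second that of `ℓ` times the binary logarithm.
  thresholdConstant : ℝ
  thresholdConstant = fromℕ 2 * fromℕ 4 * L⁻¹ + fromℕ 2

  0<thresholdConstant : 0# < thresholdConstant
  0<thresholdConstant = begin-strict
    0#                                   <⟨ 0<2 ⟩
    fromℕ 2                              ≤⟨ x≤x+y (*-nonNeg (*-nonNeg (0≤fromℕ 2) (0≤fromℕ 4)) 0≤L⁻¹) ⟩
    fromℕ 2 + fromℕ 2 * fromℕ 4 * L⁻¹    ≈⟨ +-comm _ _ ⟩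
    thresholdConstant                    ∎

  module _ {ε δ : ℝ} (ℓ : ℕ) (0<ε : 0# < ε) (0<δ : 0# < δ) (δ<1 : δ < 1#) where

    -- The threshold is `X` times twice `ℓ`, and `X` is `a + M` divided by the logarithm of 2.
    q a M z X : ℝ
    q = 1# - δ
    a = fromℕ 4 * ε * fromℕ ℓ
    M = log (1# / q)
    z = exp a / q
    X = log₂ z

    0<q : 0# < q
    0<q = x<y⇒0<y-x δ<1

    q≤1 : q ≤ 1#
    q≤1 = <⇒≤ (x<y+z⇒x-y<z (begin-strict
      1#       ≈⟨ +-identityˡ 1# ⟨
      0# + 1#  <⟨ +-monoˡ-< 1# 0<δ ⟩
      δ + 1#   ∎))

    0≤a : 0# ≤ a
    0≤a = *-nonNeg (*-nonNeg (0≤fromℕ 4) (<⇒≤ 0<ε)) (0≤fromℕ ℓ)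

    0<z : 0# < z
    0<z = *-pos (0<exp a) (⁻¹-pos 0<q)

    0≤M : 0# ≤ M
    0≤M = 1≤x⇒0≤log[x] (1≤1/x 0<q q≤1)

    log[z]≈a+M : log z ≈ a + M
    log[z]≈a+M = exp[y]≈x⇒log[x]≈y 0<z (begin-equality
      exp (a + M)            ≈⟨ exp-+ a M ⟩
      exp a * exp M          ≈⟨ *-congˡ (exp-log (1# / q) (*-pos 0<1 (⁻¹-pos 0<q))) ⟩
      exp a * (1# * q ⁻¹)    ≈⟨ *-congˡ (*-identityˡ (q ⁻¹)) ⟩
      exp a / q              ∎)

    0≤X : 0# ≤ X
    0≤X = *-nonNeg (≤-trans (+-nonNeg 0≤a 0≤M) (≤-reflexive (sym log[z]≈a+M))) 0≤L⁻¹

    lengthThreshold-nonNeg : 0# ≤ lengthThreshold R ε δ ℓ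
    lengthThreshold-nonNeg = *-nonNeg (*-nonNeg (0≤fromℕ 2) (0≤fromℕ ℓ)) 0≤X

    lengthThreshold≤ : lengthThreshold R ε δ ℓ
      ≤ thresholdConstant * (ε * (fromℕ ℓ * fromℕ ℓ) + fromℕ ℓ * log₂ (1# / q))
    lengthThreshold≤ = begin
      two * l * (log z * L⁻¹)      ≈⟨ *-congˡ (*-congʳ log[z]≈a+M) ⟩
      -- The nonnegative terms added here are the cross terms that arise when the two-summand
      -- constant is multiplied out.
      two * l * ((a + M) * L⁻¹)    ≤⟨ x≤x+y (+-nonNeg
        (*-nonNeg (*-nonNeg (*-nonNeg (0≤fromℕ 2) (0≤fromℕ 4)) 0≤L⁻¹)
                  (*-nonNeg (0≤fromℕ ℓ) (*-nonNeg 0≤M 0≤L⁻¹)))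
        (*-nonNeg (0≤fromℕ 2) (*-nonNeg (<⇒≤ 0<ε) (*-nonNeg (0≤fromℕ ℓ) (0≤fromℕ ℓ))))) ⟩
      two * l * ((a + M) * L⁻¹) +
        (two * four * L⁻¹ * (l * (M * L⁻¹)) + two * (ε * (l * l)))
        ≈⟨ solve 6 (λ t f e l m i →
             t :* l :* ((f :* e :* l :+ m) :* i) :+
               (t :* f :* i :* (l :* (m :* i)) :+ t :* (e :* (l :* l))) :=
             (t :* f :* i :+ t) :* (e :* (l :* l) :+ l :* (m :* i)))
             refl two four ε l M L⁻¹ ⟩
      thresholdConstant * (ε * (l * l) + l * (M * L⁻¹)) ∎
      where
      two four l : ℝ
      two  = fromℕ 2
      four = fromℕ 4
      l    = fromℕ ℓ

    module _ (0<ℓ : 0 ℕ.< ℓ) where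

      -- The factor 4 in the threshold absorbs the extra privacy loss: as `ℓ` is at least 1, its
      -- successor is at most twice `ℓ`.
      [1+ℓ]*ε≤a : fromℕ (suc ℓ) * ε ≤ a
      [1+ℓ]*ε≤a = begin
        (1# + l) * ε                     ≤⟨ *-monoʳ-≤ (<⇒≤ 0<ε) (+-monoˡ-≤ l (1≤fromℕ 0<ℓ)) ⟩
        (l + l) * ε                      ≤⟨ x≤x+y (*-nonNeg (+-nonNeg (0≤fromℕ ℓ) (0≤fromℕ ℓ)) (<⇒≤ 0<ε)) ⟩
        (l + l) * ε + (l + l) * ε        ≈⟨ solve 2 (λ l e →
          (l :+ l) :* e :+ (l :+ l) :* e :=
          (con 1 :+ (con 1 :+ (con 1 :+ (con 1 :+ con 0)))) :* e :* l) refl l ε ⟩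
        a                                ∎
        where
        l : ℝ
        l = fromℕ ℓ

      X≤lengthThreshold : X ≤ lengthThreshold R ε δ ℓ
      X≤lengthThreshold = begin
        X                          ≈⟨ *-identityˡ X ⟨
        1# * X                     ≤⟨ *-monoʳ-≤ 0≤X (begin
          1#                         ≤⟨ 1≤fromℕ 0<ℓ ⟩
          fromℕ ℓ                    ≈⟨ *-identityˡ (fromℕ ℓ) ⟨
          1# * fromℕ ℓ               ≤⟨ *-monoʳ-≤ (0≤fromℕ ℓ) (1≤fromℕ {2} (ℕ.s≤s ℕ.z≤n)) ⟩
          fromℕ 2 * fromℕ ℓ          ∎) ⟩
        fromℕ 2 * fromℕ ℓ * X      ∎

      -- Solving `bound` for the power of two gives at most `exp b / q`, hence at most `z`; binary
      -- logarithms then give `X`.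
      T≤lengthThreshold : ∀ T →
        fromℕ (2 ℕ.^ T) * (q * exp (- (fromℕ (suc ℓ) * ε))) ≤ 1# →
        fromℕ T ≤ lengthThreshold R ε δ ℓ
      T≤lengthThreshold T bound = begin
        fromℕ T              ≈⟨ *-inverseˡ-cancel (<⇒≉˘ 0<log[2]) (fromℕ T) ⟨
        fromℕ T * L * L⁻¹    ≤⟨ *-monoʳ-≤ 0≤L⁻¹ (exp[y]≤x⇒y≤log[x] 0<z exp[T*L]≤z) ⟩
        X                    ≤⟨ X≤lengthThreshold ⟩
        lengthThreshold R ε δ ℓ  ∎
        where
        b : ℝ
        b = fromℕ (suc ℓ) * ε

        exp[T*L]≤z : exp (fromℕ T * L) ≤ z
        exp[T*L]≤z = begin
          exp (fromℕ T * L)            ≈⟨ fromℕ-2^ T ⟨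
          N                            ≈⟨ *-identityʳ N ⟨
          N * 1#                       ≈⟨ *-congˡ (*-identityʳ 1#) ⟨
          -- Both units are expanded into products with inverses, so that regrouping exposes the
          -- left side of `bound`.
          N * (1# * 1#)                ≈⟨ *-congˡ (*-cong (*-inverseʳ q (<⇒≉˘ 0<q)) (exp-inverseʳ b)) ⟨
          N * ((q * q ⁻¹) * (exp b * exp (- b)))
            ≈⟨ solve 5 (λ n q i m e → n :* ((q :* i) :* (e :* m)) := n :* (q :* m) :* (e :* i))
                 refl N q (q ⁻¹) (exp (- b)) (exp b) ⟩
          N * (q * exp (- b)) * (exp b / q)
                                       ≤⟨ *-monoʳ-≤ (<⇒≤ (*-pos (0<exp b) (⁻¹-pos 0<q))) bound ⟩
          1# * (exp b / q)             ≈⟨ *-identityˡ (exp b / q) ⟩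
          exp b / q                    ≤⟨ *-monoʳ-≤ (<⇒≤ (⁻¹-pos 0<q)) (exp-mono-≤ [1+ℓ]*ε≤a) ⟩
          z                            ∎
          where
          N : ℝ
          N = fromℕ (2 ℕ.^ T)

-- Group privacy along an update path.

module Privacy (em : ExcludedMiddle 0ℓ) (R : RealNumbers) {W : Set} {n : ℕ}
               (𝒜 : OnlineAlgorithm R W n) (T : ℕ) where
  open RealNumbers R hiding (zero)
  open Reals em R
  open Sequences em {W} {n}
  open OnlineAlgorithm 𝒜
  open import Relation.Binary.Reasoning.PartialOrder poset
  open import Relation.Binary.Construct.NonStrictToStrict _≈_ _≤_ using (<⇒≤)

  PrIn : Vector (Graph W n) T → Pred (Vector ℝ T) 0ℓ → ℝ
  PrIn h S = Pr (λ ω → outputs (sequence h) ω ∈ S)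

  select : Graph W n → Graph W n → Fin 2 → Graph W n
  select G H zero    = G
  select G H (suc _) = H

  -- Every step of the path from G to H changes a single edge, so doing it
  -- at all the selected times at once stays user-level adjacent.
  group-privacy : ∀ {ε} → IsUserLevelEdgePrivate R 𝒜 T ε → Edge n → Fin T →
    ∀ {S} → Borel R S → ∀ {B G H k} (b : Vector (Fin 2) T) → G ⟶[ k ] H →
    ∀ {h} → (∀ t → h t ≗ select B G (b t)) →
    PrIn (select B H ∘ b) S ≤ exp (fromℕ (suc k) * ε) * PrIn h S
  -- The endpoints of a path of length 0 agree only pointwise, so even this case costs one use of
  -- privacy; hence `suc k` in the exponent.
  group-privacy {ε} private-𝒜 e t₀ {S} S-Borel {B} {H = H} b (done {G} G≗H) {h} h≗ = begin
    PrIn (select B H ∘ b) S        ≤⟨ private-𝒜 _ _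
      (e , Adjacent-sym e (≗⇒Adjacent e t₀ (λ t e′ → ≡.trans (h≗ t e′) (G≗H′ (b t) e′)))) S S-Borel ⟩
    exp ε * PrIn h S               ≈⟨ *-congʳ (exp-cong
      (trans (*-congʳ (+-identityʳ 1#)) (*-identityˡ ε))) ⟨
    exp (fromℕ 1 * ε) * PrIn h S   ∎
    where
    G≗H′ : ∀ i → select B G i ≗ select B H i
    G≗H′ zero    _ = ≡.refl
    G≗H′ (suc _)   = G≗H
  -- The rest of the path starts from `select B H ∘ b` itself; the adjacency for the first step
  -- absorbs the pointwise discrepancy of `h`.
  group-privacy {ε} private-𝒜 e t₀ {S} S-Borel {B} {H = K} b
                (step {G} {H} {k = k} (e′ , G→H) path) {h} h≗ = begin
    PrIn (select B K ∘ b) S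
      ≤⟨ group-privacy private-𝒜 e t₀ S-Borel b path (λ _ _ → ≡.refl) ⟩
    exp (fromℕ (suc k) * ε) * PrIn (select B H ∘ b) S
      ≤⟨ *-monoˡ-≤ (<⇒≤ (0<exp _)) (private-𝒜 _ _ (e′ , adjacent G→H) S S-Borel) ⟩
    exp (fromℕ (suc k) * ε) * (exp ε * PrIn h S)
      ≈⟨ *-assoc _ _ _ ⟨
    exp (fromℕ (suc k) * ε) * exp ε * PrIn h S
      ≈⟨ *-congʳ (trans (*-comm _ _) (sym (exp-+ _ _))) ⟩
    exp (ε + fromℕ (suc k) * ε) * PrIn h S
      ≈⟨ *-congʳ (exp-cong (trans (+-congʳ (sym (*-identityˡ ε))) (sym (distribʳ ε 1# _)))) ⟩
    exp (fromℕ (suc (suc k)) * ε) * PrIn h S ∎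
    where
    -- An insertion makes the new sequence the larger one, a deletion the smaller one; letter 0
    -- means no change in both cases.
    adjacent : IsExtension e′ H G ⊎ IsExtension e′ G H →
               Adjacent e′ (sequence (select B H ∘ b)) (sequence h)
    adjacent (inj₁ H⊃G) = drops⇒Adjacent e′ t₀ λ t → drops t (b t) (h≗ t)
      where
      drops : ∀ t i → h t ≗ select B G i → DropsAtMost e′ (select B H i) (h t)
      drops t zero    h≗B = inj₁ (λ e″ → ≡.sym (h≗B e″))
      drops t (suc _) h≗G = inj₂
        (IsExtension-resp (λ _ → ≡.refl) (λ e″ → ≡.sym (h≗G e″)) H⊃G)
    adjacent (inj₂ G⊃H) = Adjacent-sym e′ (drops⇒Adjacent e′ t₀ λ t → drops t (b t) (h≗ t))
      where
      drops : ∀ t i → h t ≗ select B G i → DropsAtMost e′ (h t) (select B H i)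
      drops t zero    h≗B = inj₁ h≗B
      drops t (suc _) h≗G = inj₂
        (IsExtension-resp (λ e″ → ≡.sym (h≗G e″)) (λ _ → ≡.refl) G⊃H)

  -- Accuracy events and the packing bound.

  Near : Vector ℝ T → ℝ → Pred (Vector ℝ T) 0ℓ
  Near v r x = ∀ t → ∣ x t - v t ∣ < r

  -- Each coordinate condition is an open interval, hence a generator, and there are finitely many
  -- coordinates.
  Near-Borel : ∀ v r → Borel R (Near v r)
  Near-Borel v r = SigmaAlgebra.∀-closed em (Borel-isSigmaAlgebra R) λ t →
    Borel.resp-≐ (bounds⇒∣x-y∣<z , ∣x-y∣<z⇒bounds) (interval t (v t - r) (v t + r))

  -- Measurability is given for one output at a time; the joint event is a finite intersection over
  -- the prefixes.
  Near-event : ∀ (𝒢 : GraphSeq W n T) v r → Event (λ ω → outputs 𝒢 ω ∈ Near v r)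
  Near-event 𝒢 v r = SigmaAlgebra.∀-closed em isSigmaAlgebra λ t →
    IsSigmaAlgebra.resp-≐ isSigmaAlgebra (bounds⇒∣x-y∣<z , ∣x-y∣<z⇒bounds)
      (measurable (prefix 𝒢 t) (v t - r) (v t + r))

  -- A packing argument: one disjoint event per word, each of probability at least `q` times the
  -- inverse group privacy factor. `e` and `t₀` locate the deletion that links pointwise equal
  -- sequences.
  private-accurate⇒2^T≤ : ∀ {ε r q ℓ} (f : GraphFunction R W n) {G₁ G₂} →
    IsUserLevelEdgePrivate R 𝒜 T ε → ComputesWithin R 𝒜 T f r q →
    Edge n → Fin T → G₁ ⟶[ ℓ ] G₂ → r + r ≤ ∣ Func.to f G₁ - Func.to f G₂ ∣ →
    fromℕ (2 ℕ.^ T) * (q * exp (- (fromℕ (suc ℓ) * ε))) ≤ 1#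
  private-accurate⇒2^T≤ {ε} {r} {q} {ℓ} f {G₁} {G₂} private-𝒜 accurate e t₀ path gap =
    disjoint⇒N*p≤1 E (λ i → Near-event (sequence h₀) (values (bits i)) r) E-disjoint p≤PrE
    where
    open Probability em R space
    open Func f using (to; cong)

    bits : Fin (2 ℕ.^ T) → Vector (Fin 2) T
    bits = finToFun

    hs : Vector (Fin 2) T → Vector (Graph W n) T
    hs b = select G₁ G₂ ∘ b

    values : Vector (Fin 2) T → Vector ℝ T
    values b t = to (graphs (sequence (hs b)) t)

    h₀ : Vector (Graph W n) T
    h₀ _ = G₁

    -- All events concern the same input `h₀`; only the target values vary with the word.
    E : Fin (2 ℕ.^ T) → Pred Ω 0ℓ
    E i ω = outputs (sequence h₀) ω ∈ Near (values (bits i)) r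

    value≈ : ∀ b t → values b t ≈ to (hs b t)
    value≈ b t = cong (graphs-sequence (hs b) t)

    -- An output within `r` of both values would force them closer than `r + r`, against `gap`.
    separated : ∀ {u x y} → x ≈ to G₁ → y ≈ to G₂ → ∣ u - x ∣ < r → ¬ (∣ u - y ∣ < r)
    separated {u} {x} {y} x≈ y≈ ux uy =
      <⇒≱ (begin-strict
        ∣ to G₁ - to G₂ ∣  ≈⟨ ∣∣-cong (+-cong x≈ (-‿cong y≈)) ⟨
        ∣ x - y ∣          <⟨ ∣u-x∣<r⇒∣u-y∣<r⇒∣x-y∣<r+r ux uy ⟩
        r + r              ∎) gap

    E-disjoint : ∀ {i j} → i ≢ j → E i ⊥ E j
    E-disjoint {i} {j} i≢j {ω} (ω∈Ei , ω∈Ej) = i≢j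
      (≡.trans (≡.sym (funToFin-finToFin {T} {2} i))
      (≡.trans (funToFin-cong same) (funToFin-finToFin {T} {2} j)))
      where
      same : bits i ≗ bits j
      same t with bits i t in eqᵢ | bits j t in eqⱼ | ω∈Ei t | ω∈Ej t
      ... | zero     | zero     | _ | _ = ≡.refl
      ... | suc zero | suc zero | _ | _ = ≡.refl
      ... | zero     | suc zero | near₁ | near₂ = contradiction near₂ (separated
        (trans (value≈ (bits i) t) (reflexive (≡.cong (to ∘ select G₁ G₂) eqᵢ)))
        (trans (value≈ (bits j) t) (reflexive (≡.cong (to ∘ select G₁ G₂) eqⱼ))) near₁)
      ... | suc zero | zero     | near₂ | near₁ = contradiction near₂ (separated
        (trans (value≈ (bits j) t) (reflexive (≡.cong (to ∘ select G₁ G₂) eqⱼ)))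
        (trans (value≈ (bits i) t) (reflexive (≡.cong (to ∘ select G₁ G₂) eqᵢ))) near₁)

    c : ℝ
    c = fromℕ (suc ℓ) * ε

    -- Before the first step of the path, selected and unselected times both carry `G₁`, so `h₀` is
    -- the starting sequence for every word.
    G₁≗select : ∀ i → G₁ ≗ select G₁ G₁ i
    G₁≗select zero    _ = ≡.refl
    G₁≗select (suc _) _ = ≡.refl

    p≤PrE : ∀ i → q * exp (- c) ≤ Pr (E i)
    p≤PrE i = begin
      q * exp (- c)                   ≤⟨ *-monoʳ-≤ (<⇒≤ (0<exp (- c))) (begin
        q                               ≤⟨ accurate (sequence (hs (bits i))) ⟩
        PrIn (hs (bits i)) S            ≤⟨ group-privacy private-𝒜 e t₀
                                             (Near-Borel _ r) (bits i) path (λ t → G₁≗select (bits i t)) ⟩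
        exp c * Pr (E i)                ∎) ⟩
      exp c * Pr (E i) * exp (- c)    ≈⟨ *-congʳ (*-comm (exp c) (Pr (E i))) ⟩
      Pr (E i) * exp c * exp (- c)    ≈⟨ *-assoc _ _ _ ⟩
      Pr (E i) * (exp c * exp (- c))  ≈⟨ *-congˡ (exp-inverseʳ c) ⟩
      Pr (E i) * 1#                   ≈⟨ *-identityʳ _ ⟩
      Pr (E i)                        ∎
      where
      S : Pred (Vector ℝ T) 0ℓ
      S = Near (values (bits i)) r

path-nonEmpty : ∀ {W : Set} {n k} {G H : Graph W n} → G ⟶[ k ] H → ¬ (G ≗ H) → 0 ℕ.< k
path-nonEmpty (done G≗H) G≭H = contradiction G≗H G≭H
path-nonEmpty (step _ _) _   = ℕ.s≤s ℕ.z≤n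

-- The lower bound on the error.

module LowerBound (em : ExcludedMiddle 0ℓ) (R : RealNumbers) where
  open RealNumbers R hiding (zero)
  open Reals em R
  open Threshold em R
  open import Relation.Binary.Reasoning.PartialOrder poset
  open import Algebra.Solver.Ring.NaturalCoefficients.Default commutativeSemiring
    using (solve; _:=_; _:+_; _:*_; con)

  -- The absolute constant of the error bound: balls of radius half the spread around the two values
  -- of the function are disjoint.
  ½ : ℝ
  ½ = fromℕ 2 ⁻¹

  0<½ : 0# < ½
  0<½ = ⁻¹-pos 0<2

  ½x+½x≈x : ∀ x → ½ * x + ½ * x ≈ x
  ½x+½x≈x x = begin-equality
    ½ * x + ½ * x      ≈⟨ solve 2 (λ h x →
                            h :* x :+ h :* x := (con 1 :+ (con 1 :+ con 0)) :* h :* x)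
                            refl ½ x ⟩
    fromℕ 2 * ½ * x    ≈⟨ *-congʳ (*-inverseʳ (fromℕ 2) (<⇒≉˘ 0<2)) ⟩
    1# * x             ≈⟨ *-identityˡ x ⟩
    x                  ∎

  private-accurate⇒T≤lengthThreshold :
    ∀ {ε δ} → 0# < ε → 0# < δ → δ < 1# →
    ∀ {W : Set} {n s ℓ} (f : GraphFunction R W n) (e : Edge n) →
    HasSpreadSparing R f s ℓ e → 0 ℕ.< s →
    ∀ T (𝒜 : OnlineAlgorithm R W n) → IsUserLevelEdgePrivate R 𝒜 T ε →
    ComputesWithin R 𝒜 T f (½ * fromℕ s) (1# - δ) →
    fromℕ T ≤ lengthThreshold R ε δ ℓ
  -- With no updates there is no time `t₀` for the packing bound, but the threshold is nonnegative.
  private-accurate⇒T≤lengthThreshold 0<ε 0<δ δ<1 {ℓ = ℓ} _ _ _ _ zero _ _ _ =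
    lengthThreshold-nonNeg ℓ 0<ε 0<δ δ<1
  private-accurate⇒T≤lengthThreshold 0<ε 0<δ δ<1 {s = s} {ℓ} f e
    (G₁ , G₂ , s≤gap , (path , _) , _) 0<s T@(suc _) 𝒜 private-𝒜 accurate =
    T≤lengthThreshold ℓ 0<ε 0<δ δ<1 0<ℓ T
      (private-accurate⇒2^T≤ f private-𝒜 accurate e zero path
        (≤-trans (≤-reflexive (½x+½x≈x (fromℕ s))) s≤gap))
    where
    open Privacy em R 𝒜 T

    -- A path of length 0 would give the function equal values on both graphs, against the positive
    -- spread.
    0<ℓ : 0 ℕ.< ℓ
    0<ℓ = path-nonEmpty path λ G₁≗G₂ → <⇒≱ (0<fromℕ 0<s)
      (≤-trans s≤gap (≤-reflexive (x≈y⇒∣x-y∣≈0 (Func.cong f G₁≗G₂))))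

theorem45 : ExcludedMiddle 0ℓ → (R : RealNumbers) →
    let open RealNumbers R in
    (∃[ C ] 0# < C ×
    (∀ (ε δ : ℝ) (ℓ : ℕ) → 0# < ε → 0# < δ → δ < 1# →
    lengthThreshold R ε δ ℓ
    ≤ C * (ε * (fromℕ ℓ * fromℕ ℓ) + fromℕ ℓ * log₂ (1# / (1# - δ)))))
    ×
    (∃[ c ] 0# < c ×
    (∀ (ε δ : ℝ) → 0# < ε → 0# < δ → δ < 1# →
    ∀ (W : Set) (s ℓ : ℕ → ℕ) → (∀ m → 2 ∣ s m) → (∀ m → 2 ∣ ℓ m) →
    ∀ (n : ℕ) (f : GraphFunction R W n) (e : Edge n) →
    HasSpreadSparing R f (s n) (ℓ n) e →
    0 ℕ.< s n →
    ∀ (T : ℕ) → lengthThreshold R ε δ (ℓ n) < fromℕ T →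
    ¬ (∃[ 𝒜 ] IsUserLevelEdgePrivate R {W} {n} 𝒜 T ε ×
    ComputesWithin R 𝒜 T f (c * fromℕ (s n)) (1# - δ))))
theorem45 em R =
  ( thresholdConstant , 0<thresholdConstant
  , λ ε δ ℓ 0<ε 0<δ δ<1 → lengthThreshold≤ ℓ 0<ε 0<δ δ<1 )
  , ½ , 0<½
  , λ ε δ 0<ε 0<δ δ<1 W s ℓ _ _ n f e spread 0<s T threshold<T (𝒜 , private-𝒜 , accurate) →
      <⇒≱ threshold<T
        (private-accurate⇒T≤lengthThreshold 0<ε 0<δ δ<1 f e spread 0<s T 𝒜 private-𝒜 accurate)
  where
  open Reals em R
  open Threshold em R
  open LowerBound em R
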